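{- Let $a\ge2$ and $b\ge1$ be integers, and let $\Delta_{n,k}$ denote the number of vertices of the Horadam cube $\Pi^{a,b}_n$ with exactly $k$ neighbors. Then for all $n\ge2$ and all $k\ge 0$, $$\Delta_{n,k}=2\Delta_{n-1,k-1}+(a-2)\Delta_{n-1,k-2}+\Delta_{n-2,k-1}+(b-2)\Delta_{n-2,k-2}+\Delta_{n-2,k-3},$$ with initial values $\Delta_{0,0}=1$, $\Delta_{1,1}=2$ and $\Delta_{1,2}=a-2$ (all other $\Delta_{0,k}$ and $\Delta_{1,k}$ being $0$).
   Context: For integers $a,b\ge1$ and $n\ge 0$, $\mathcal S^{a,b}_n$ is the set of all strings of length $n$ over the alphabet $\{0,1,\dots,a+b-1\}$ in which every letter from $\{a,\dots,a+b-1\}$ appears only immediately after a letter $0$; $\mathcal S^{a,b}_0$ contains only the empty string. The Horadam cube $\Pi^{a,b}_n$ is the simple graph with vertex set $\mathcal S^{a,b}_n$ in which $x_1\cdots x_n$ and $y_1\cdots y_n$ are adjacent if and only if $\sum_{i=1}^n|x_i-y_i|=1$. By convention $\Delta_{n,k}=0$ for $k<0$. -}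

module Defs where

open import Data.Fin using (Fin; toℕ)
open import Data.Fin.Properties using (all?; any?)
open import Data.Integer using (ℤ; +_; -[1+_])
open import Data.List using (List; []; _∷_; length; filter; allFin; cartesianProductWith)
open import Data.List.Membership.Propositional using (_∈_)
open import Data.List.Membership.Propositional.Properties using (∈-allFin; ∈-cartesianProductWith⁺; ∈-filter⁺; ∈-filter⁻)
open import Data.List.Relation.Unary.All using ([])
open import Data.List.Relation.Unary.AllPairs using ([]; _∷_)
open import Data.List.Relation.Unary.Any using (here)
open import Data.List.Relation.Unary.Unique.Propositional using (Unique)
open import Data.List.Relation.Unary.Unique.Propositional.Properties using (allFin⁺; cartesianProductWith⁺; filter⁺)
open import Data.Nat using (ℕ; zero; suc; _+_; _≤_; _≤?_; _≟_; ∣_-_∣)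
open import Data.Product using (_×_; ∃-syntax; proj₂)
open import Data.Vec as Vec using (Vec; []; _∷_; lookup; zipWith)
open import Data.Vec.Properties using (∷-injective)
open import Function using (_⇔_; mk⇔)
open import Relation.Binary.PropositionalEquality using (_≡_; refl)
open import Relation.Nullary using (Dec; _→-dec_; _×-dec_)

Word : ℕ → ℕ → Set
Word m n = Vec (Fin m) n

words : ∀ m n → List (Word m n)
words m zero    = [] ∷ []
words m (suc n) = cartesianProductWith _∷_ (allFin m) (words m n)

words-complete : ∀ {m n} (x : Word m n) → x ∈ words m n
words-complete []       = here refl
words-complete (c ∷ x) = ∈-cartesianProductWith⁺ _∷_ (∈-allFin c) (words-complete x)

words-unique : ∀ m n → Unique (words m n)
words-unique m zero    = [] ∷ []
words-unique m (suc n) = cartesianProductWith⁺ _∷_ ∷-injective (allFin⁺ m) (words-unique m n)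

module Horadam (a b : ℕ) where

  IsVertex : ∀ {n} → Word (a + b) n → Set
  IsVertex {n} x = (i : Fin n) → a ≤ toℕ (lookup x i) →
    ∃[ j ] (suc (toℕ j) ≡ toℕ i × toℕ (lookup x j) ≡ 0)

  isVertex? : ∀ {n} (x : Word (a + b) n) → Dec (IsVertex x)
  isVertex? x = all? λ i → (a ≤? toℕ (lookup x i)) →-dec
    any? λ j → (suc (toℕ j) ≟ toℕ i) ×-dec (toℕ (lookup x j) ≟ 0)

  vertices : ∀ n → List (Word (a + b) n)
  vertices n = filter isVertex? (words (a + b) n)

  ∈-vertices : ∀ {n} {x : Word (a + b) n} → x ∈ vertices n ⇔ IsVertex x
  ∈-vertices {n} {x} = mk⇔
    (λ x∈ → proj₂ (∈-filter⁻ isVertex? {xs = words (a + b) n} x∈))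
    (∈-filter⁺ isVertex? (words-complete x))

  vertices-unique : ∀ n → Unique (vertices n)
  vertices-unique n = filter⁺ isVertex? (words-unique (a + b) n)

  Adjacent : ∀ {n} → Word (a + b) n → Word (a + b) n → Set
  Adjacent x y = Vec.sum (zipWith (λ c d → ∣ toℕ c - toℕ d ∣) x y) ≡ 1

  adjacent? : ∀ {n} (x y : Word (a + b) n) → Dec (Adjacent x y)
  adjacent? x y = Vec.sum (zipWith (λ c d → ∣ toℕ c - toℕ d ∣) x y) ≟ 1

  degree : ∀ {n} → Word (a + b) n → ℕ
  degree {n} x = length (filter (adjacent? x) (vertices n))

  verticesOfDegree : ∀ n → ℕ → List (Word (a + b) n)
  verticesOfDegree n k = filter (λ x → degree x ≟ k) (vertices n)

  -- Integer-valued because the coefficient b - 2 of the recurrence may be negative.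
  Δ : ℕ → ℤ → ℤ
  Δ n (+ k)    = + length (verticesOfDegree n k)
  Δ n -[1+ _ ] = + 0

{-# OPTIONS --safe #-}

-- Classify a vertex by its first letter c, with w the rest. For 0 < c < a - 1 the letter
-- adds 2 to the degree of w, for c = a - 1 it adds 1; for c = 0 the word w is counted in the
-- larger set of words allowed after a 0, which yields a second recursion. Subtracting a shift
-- of the first recursion from the second eliminates the auxiliary counts. Instead of Δ the
-- recursions are proved for sums of φ(degree) with φ arbitrary, so that shifts of k become
-- shifts of φ and negative indices do not occur.
module Submission where

open import Defs
open import Data.Bool using (Bool; true; false; T; _∧_; _∨_; if_then_else_)
open import Data.Bool.Properties using (T-∧; T-∨; T-≡; ∨-zeroʳ; ∧-zeroʳ; ∧-identityʳ)
open import Data.Empty using (⊥-elim)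
open import Data.Fin using (Fin; zero; suc; toℕ; _↑ˡ_; _↑ʳ_)
open import Data.Fin.Properties using (toℕ-↑ˡ; toℕ-↑ʳ)
open import Data.Integer using (ℤ; +_; -[1+_]; _+_; _-_; _*_)
open import Data.Integer.Properties using (m-n≡m⊖n; [1+m]⊖[1+n]≡m⊖n; pos-*)
open import Data.Integer.Tactic.RingSolver using (solve-∀)
open import Data.List using (List; []; _∷_; _++_; map; filter; length; allFin; cartesianProductWith)
open import Data.List.Properties using (map-tabulate; map-++; map-∘; map-cong)
open import Data.Nat as ℕ using (ℕ; zero; suc; _∸_; _<ᵇ_; _≡ᵇ_; s≤s; z≤n; ∣_-_∣)
open import Data.Nat.ListAction using (sum)
open import Data.Nat.ListAction.Properties using (sum-++)
import Data.Nat.Properties as ℕₚ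
import Data.Nat.Tactic.RingSolver as ℕ-Solver
open import Data.Product using (_×_; _,_; proj₁; proj₂; ∃-syntax)
open import Data.Sum using (_⊎_; inj₁; inj₂; [_,_]′)
open import Data.Unit using (tt)
open import Data.Vec as Vec using ([]; _∷_; lookup; zipWith)
open import Function using (_∘_; mk⇔; Equivalence)
open import Relation.Binary.PropositionalEquality
  using (_≡_; _≢_; refl; sym; trans; cong; cong₂; subst; module ≡-Reasoning)
open import Relation.Nullary using (Dec; does; yes; no)
open import Relation.Nullary.Decidable using (T?; does-⇔)
open import Relation.Unary using (Decidable)

open ≡-Reasoning

-- Sums and indicators

⟦_⟧ : Bool → ℕ
⟦ true ⟧  = 1
⟦ false ⟧ = 0

T⇒≡true : ∀ {x} → T x → x ≡ true
T⇒≡true = Equivalence.to T-≡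

∑ : {A : Set} → List A → (A → ℕ) → ℕ
∑ xs f = sum (map f xs)

module _ {A : Set} where

  ∑-cong : ∀ (xs : List A) {f g : A → ℕ} → (∀ x → f x ≡ g x) → ∑ xs f ≡ ∑ xs g
  ∑-cong xs f≗g = cong sum (map-cong f≗g xs)

  ∑-zero : ∀ (xs : List A) {f : A → ℕ} → (∀ x → f x ≡ 0) → ∑ xs f ≡ 0
  ∑-zero []       f≗0 = refl
  ∑-zero (x ∷ xs) f≗0 = cong₂ ℕ._+_ (f≗0 x) (∑-zero xs f≗0)

  ∑-+ : ∀ (xs : List A) (f g : A → ℕ) → ∑ xs (λ x → f x ℕ.+ g x) ≡ ∑ xs f ℕ.+ ∑ xs g
  ∑-+ []       f g = refl
  ∑-+ (x ∷ xs) f g = trans (cong (f x ℕ.+ g x ℕ.+_) (∑-+ xs f g)) (interchange (f x) (g x) _ _)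
    where
    interchange : ∀ a b c d → a ℕ.+ b ℕ.+ (c ℕ.+ d) ≡ a ℕ.+ c ℕ.+ (b ℕ.+ d)
    interchange = ℕ-Solver.solve-∀

  ∑-* : ∀ k (xs : List A) (f : A → ℕ) → ∑ xs (λ x → k ℕ.* f x) ≡ k ℕ.* ∑ xs f
  ∑-* k []       f = sym (ℕₚ.*-zeroʳ k)
  ∑-* k (x ∷ xs) f = trans (cong (k ℕ.* f x ℕ.+_) (∑-* k xs f)) (sym (ℕₚ.*-distribˡ-+ k (f x) _))

  ∑-++ : ∀ (xs ys : List A) (f : A → ℕ) → ∑ (xs ++ ys) f ≡ ∑ xs f ℕ.+ ∑ ys f
  ∑-++ xs ys f = trans (cong sum (map-++ f xs ys)) (sum-++ (map f xs) (map f ys))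

  ∑-filter : ∀ {P : A → Set} (P? : Decidable P) (xs : List A) (f : A → ℕ) →
    ∑ (filter P? xs) f ≡ ∑ xs (λ x → ⟦ does (P? x) ⟧ ℕ.* f x)
  ∑-filter P? []       f = refl
  ∑-filter P? (x ∷ xs) f with does (P? x)
  ... | true  = cong₂ ℕ._+_ (sym (ℕₚ.*-identityˡ (f x))) (∑-filter P? xs f)
  ... | false = ∑-filter P? xs f

  length-filter : ∀ {P : A → Set} (P? : Decidable P) (xs : List A) →
    length (filter P? xs) ≡ ∑ xs (λ x → ⟦ does (P? x) ⟧)
  length-filter P? []       = refl
  length-filter P? (x ∷ xs) with does (P? x)
  ... | true  = cong suc (length-filter P? xs)
  ... | false = length-filter P? xs

∑-cartesianProductWith : {A B C : Set} (g : A → B → C) (xs : List A) (ys : List B) (f : C → ℕ) →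
  ∑ (cartesianProductWith g xs ys) f ≡ ∑ xs (λ x → ∑ ys (λ y → f (g x y)))
∑-cartesianProductWith g []       ys f = refl
∑-cartesianProductWith g (x ∷ xs) ys f = trans (∑-++ (map (g x) ys) _ f)
  (cong₂ ℕ._+_ (cong sum (sym (map-∘ ys))) (∑-cartesianProductWith g xs ys f))

∑-allFin-suc : ∀ n (f : Fin (suc n) → ℕ) →
  ∑ (allFin (suc n)) f ≡ f zero ℕ.+ ∑ (allFin n) (f ∘ suc)
∑-allFin-suc n f = cong (λ xs → f zero ℕ.+ sum xs)
  (trans (map-tabulate suc f) (sym (map-tabulate (λ c → c) (f ∘ suc))))

∑-allFin-+ : ∀ m n (f : Fin (m ℕ.+ n) → ℕ) →
  ∑ (allFin (m ℕ.+ n)) f ≡ ∑ (allFin m) (λ c → f (c ↑ˡ n)) ℕ.+ ∑ (allFin n) (λ c → f (m ↑ʳ c))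
∑-allFin-+ zero    n f = refl
∑-allFin-+ (suc m) n f = begin
  ∑ (allFin (suc m ℕ.+ n)) f                    ≡⟨ ∑-allFin-suc (m ℕ.+ n) f ⟩
  f zero ℕ.+ ∑ (allFin (m ℕ.+ n)) (f ∘ suc)     ≡⟨ cong (f zero ℕ.+_) (∑-allFin-+ m n (f ∘ suc)) ⟩
  _                                             ≡⟨ sym (ℕₚ.+-assoc (f zero) _ _) ⟩
  _                                             ≡⟨ cong₂ ℕ._+_ (sym (∑-allFin-suc m (λ c → f (c ↑ˡ n)))) refl ⟩
  _                                             ∎

-- Made for the two ranges of nonzero letters, `1` to `a - 1` and `a` to `a + b - 1`: in each, only
-- the last letter is special when it is to be raised by one.
∑-allFin-init-last : ∀ n (f : Fin (suc n) → ℕ) {q r} →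
  (∀ c → toℕ c ℕ.< n → f c ≡ q) → (∀ c → toℕ c ≡ n → f c ≡ r) →
  ∑ (allFin (suc n)) f ≡ n ℕ.* q ℕ.+ r
∑-allFin-init-last zero    f init last = trans (ℕₚ.+-identityʳ (f zero)) (last zero refl)
∑-allFin-init-last (suc n) f {q} {r} init last = begin
  ∑ (allFin (suc (suc n))) f                   ≡⟨ ∑-allFin-suc (suc n) f ⟩
  f zero ℕ.+ ∑ (allFin (suc n)) (f ∘ suc)      ≡⟨ cong₂ ℕ._+_ (init zero (s≤s z≤n))
    (∑-allFin-init-last n (f ∘ suc) (λ c c<n → init (suc c) (s≤s c<n)) (λ c c≡n → last (suc c) (cong suc c≡n))) ⟩
  q ℕ.+ (n ℕ.* q ℕ.+ r)                        ≡⟨ sym (ℕₚ.+-assoc q _ r) ⟩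
  suc n ℕ.* q ℕ.+ r                            ∎

∑-words-suc : ∀ m n (f : Word m (suc n) → ℕ) →
  ∑ (words m (suc n)) f ≡ ∑ (allFin m) (λ c → ∑ (words m n) (λ w → f (c ∷ w)))
∑-words-suc m n f = ∑-cartesianProductWith _∷_ (allFin m) (words m n) f

-- Words at distance 0 and 1

-- Unfolds to the sum in `Adjacent`, so that `does (adjacent? x y)` reduces to `dist x y ≡ᵇ 1`.
dist : ∀ {m n} → Word m n → Word m n → ℕ
dist x y = Vec.sum (zipWith (λ c d → ∣ toℕ c - toℕ d ∣) x y)

∑-letter-dist0 : ∀ {m} (c : Fin m) (h : Fin m → ℕ) →
  ∑ (allFin m) (λ d → ⟦ ∣ toℕ c - toℕ d ∣ ≡ᵇ 0 ⟧ ℕ.* h d) ≡ h c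
∑-letter-dist0 {suc m} zero h = begin
  _                  ≡⟨ ∑-allFin-suc m _ ⟩
  h zero ℕ.+ 0 ℕ.+ _ ≡⟨ cong₂ ℕ._+_ (ℕₚ.+-identityʳ (h zero)) (∑-zero (allFin m) (λ _ → refl)) ⟩
  h zero ℕ.+ 0       ≡⟨ ℕₚ.+-identityʳ (h zero) ⟩
  h zero             ∎
∑-letter-dist0 {suc m} (suc c) h =
  trans (∑-allFin-suc m (λ d → ⟦ ∣ suc (toℕ c) - toℕ d ∣ ≡ᵇ 0 ⟧ ℕ.* h d)) (∑-letter-dist0 c (h ∘ suc))

-- The default 0 stands for the lower neighbour that the letter `0` lacks; `at-successor` uses it
-- likewise beyond the last letter `m - 1`. Taking `F` on ℕ instead of `Fin m` lets it be shifted by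
-- `suc` without bounds.
at-predecessor : ℕ → (ℕ → ℕ) → ℕ
at-predecessor zero    F = 0
at-predecessor (suc i) F = F i

at-successor : ℕ → ℕ → (ℕ → ℕ) → ℕ
at-successor m i F = if suc i <ᵇ m then F (suc i) else 0

∑-letter-dist1 : ∀ {m} (c : Fin m) (F : ℕ → ℕ) →
  ∑ (allFin m) (λ d → ⟦ ∣ toℕ c - toℕ d ∣ ≡ᵇ 1 ⟧ ℕ.* F (toℕ d))
    ≡ at-predecessor (toℕ c) F ℕ.+ at-successor m (toℕ c) F
∑-letter-dist1 {suc zero} zero F = refl
∑-letter-dist1 {suc (suc m)} zero F = begin
  _                 ≡⟨ ∑-allFin-suc (suc m) f ⟩
  _                 ≡⟨ ∑-allFin-suc m (f ∘ suc) ⟩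
  F 1 ℕ.+ 0 ℕ.+ _   ≡⟨ cong₂ ℕ._+_ (ℕₚ.+-identityʳ (F 1)) (∑-zero (allFin m) (λ _ → refl)) ⟩
  F 1 ℕ.+ 0         ≡⟨ ℕₚ.+-identityʳ (F 1) ⟩
  F 1               ∎
  where
  f : Fin (suc (suc m)) → ℕ
  f d = ⟦ toℕ d ≡ᵇ 1 ⟧ ℕ.* F (toℕ d)
∑-letter-dist1 {suc m} (suc c) F = begin
  _ ≡⟨ ∑-allFin-suc m (λ d → ⟦ ∣ suc (toℕ c) - toℕ d ∣ ≡ᵇ 1 ⟧ ℕ.* F (toℕ d)) ⟩
  _ ≡⟨ cong₂ ℕ._+_ refl (∑-letter-dist1 c (F ∘ suc)) ⟩
  _ ≡⟨ sym (ℕₚ.+-assoc (⟦ suc (toℕ c) ≡ᵇ 1 ⟧ ℕ.* F 0) (at-predecessor (toℕ c) (F ∘ suc)) _) ⟩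
  _ ≡⟨ cong₂ ℕ._+_ (unshift (toℕ c)) refl ⟩
  _ ∎
  where
  -- For the letter 1 the head of the sum supplies the lower neighbour that the recursive call
  -- misses; for larger letters the head vanishes and the recursive call has it.
  unshift : ∀ i → ⟦ suc i ≡ᵇ 1 ⟧ ℕ.* F 0 ℕ.+ at-predecessor i (F ∘ suc) ≡ F i
  unshift zero    = trans (ℕₚ.+-identityʳ _) (ℕₚ.*-identityˡ (F 0))
  unshift (suc i) = refl

dist0-split : ∀ s D → ⟦ s ℕ.+ D ≡ᵇ 0 ⟧ ≡ ⟦ s ≡ᵇ 0 ⟧ ℕ.* ⟦ D ≡ᵇ 0 ⟧
dist0-split zero    D = sym (ℕₚ.*-identityˡ _)
dist0-split (suc s) D = refl

-- Two naturals sum to 1 only if one is 1 and the other 0. Written as products of indicators, this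
-- separates the sum over the first letter from the sum over the rest.
dist1-split : ∀ s D → ⟦ s ℕ.+ D ≡ᵇ 1 ⟧ ≡ ⟦ s ≡ᵇ 0 ⟧ ℕ.* ⟦ D ≡ᵇ 1 ⟧ ℕ.+ ⟦ s ≡ᵇ 1 ⟧ ℕ.* ⟦ D ≡ᵇ 0 ⟧
dist1-split zero          D = sym (trans (ℕₚ.+-identityʳ _) (ℕₚ.*-identityˡ _))
dist1-split (suc zero)    D = sym (ℕₚ.*-identityˡ _)
dist1-split (suc (suc s)) D = refl

∑-word-dist0 : ∀ {m n} (x : Word m n) (g : Word m n → ℕ) →
  ∑ (words m n) (λ y → g y ℕ.* ⟦ dist x y ≡ᵇ 0 ⟧) ≡ g x
∑-word-dist0 []      g = trans (ℕₚ.+-identityʳ _) (ℕₚ.*-identityʳ (g []))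
∑-word-dist0 {m} {suc n} (c ∷ w) g = begin
  _ ≡⟨ ∑-words-suc m n _ ⟩
  ∑ (allFin m) (λ d → ∑ (words m n) (λ v → g (d ∷ v) ℕ.* ⟦ ∣ toℕ c - toℕ d ∣ ℕ.+ dist w v ≡ᵇ 0 ⟧))
    ≡⟨ ∑-cong (allFin m) inner ⟩
  ∑ (allFin m) (λ d → ⟦ ∣ toℕ c - toℕ d ∣ ≡ᵇ 0 ⟧ ℕ.* g (d ∷ w))
    ≡⟨ ∑-letter-dist0 c (λ d → g (d ∷ w)) ⟩
  g (c ∷ w) ∎
  where
  left-commute : ∀ x y z → x ℕ.* (y ℕ.* z) ≡ y ℕ.* (x ℕ.* z)
  left-commute = ℕ-Solver.solve-∀

  inner : ∀ d → ∑ (words m n) (λ v → g (d ∷ v) ℕ.* ⟦ ∣ toℕ c - toℕ d ∣ ℕ.+ dist w v ≡ᵇ 0 ⟧)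
              ≡ ⟦ ∣ toℕ c - toℕ d ∣ ≡ᵇ 0 ⟧ ℕ.* g (d ∷ w)
  inner d = begin
    _ ≡⟨ ∑-cong (words m n) (λ v → trans
           (cong (g (d ∷ v) ℕ.*_) (dist0-split ∣ toℕ c - toℕ d ∣ (dist w v)))
           (left-commute (g (d ∷ v)) ⟦ ∣ toℕ c - toℕ d ∣ ≡ᵇ 0 ⟧ _)) ⟩
    _ ≡⟨ ∑-* ⟦ ∣ toℕ c - toℕ d ∣ ≡ᵇ 0 ⟧ (words m n) _ ⟩
    _ ≡⟨ cong (⟦ ∣ toℕ c - toℕ d ∣ ≡ᵇ 0 ⟧ ℕ.*_) (∑-word-dist0 w (λ v → g (d ∷ v))) ⟩
    _ ∎

-- A single unit of distance is spent either behind the first letter or in it, and the other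
-- component then stays fixed. The weight `g` will be the indicator of validity.
∑-word-dist1 : ∀ {m n} (c : Fin m) (w : Word m n) (g : Word m (suc n) → ℕ) →
  ∑ (words m (suc n)) (λ y → g y ℕ.* ⟦ dist (c ∷ w) y ≡ᵇ 1 ⟧)
    ≡ ∑ (words m n) (λ v → g (c ∷ v) ℕ.* ⟦ dist w v ≡ᵇ 1 ⟧)
      ℕ.+ ∑ (allFin m) (λ d → ⟦ ∣ toℕ c - toℕ d ∣ ≡ᵇ 1 ⟧ ℕ.* g (d ∷ w))
∑-word-dist1 {m} {n} c w g = begin
  _ ≡⟨ ∑-words-suc m n _ ⟩
  _ ≡⟨ ∑-cong (allFin m) inner ⟩
  _ ≡⟨ ∑-+ (allFin m) _ _ ⟩
  _ ≡⟨ cong₂ ℕ._+_ (∑-letter-dist0 c _) refl ⟩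
  _ ∎
  where
  rearrange : ∀ g s₀ D₁ s₁ D₀ → g ℕ.* (s₀ ℕ.* D₁ ℕ.+ s₁ ℕ.* D₀) ≡ s₀ ℕ.* (g ℕ.* D₁) ℕ.+ s₁ ℕ.* (g ℕ.* D₀)
  rearrange = ℕ-Solver.solve-∀

  inner : ∀ d → ∑ (words m n) (λ v → g (d ∷ v) ℕ.* ⟦ ∣ toℕ c - toℕ d ∣ ℕ.+ dist w v ≡ᵇ 1 ⟧)
              ≡ ⟦ ∣ toℕ c - toℕ d ∣ ≡ᵇ 0 ⟧ ℕ.* ∑ (words m n) (λ v → g (d ∷ v) ℕ.* ⟦ dist w v ≡ᵇ 1 ⟧)
                ℕ.+ ⟦ ∣ toℕ c - toℕ d ∣ ≡ᵇ 1 ⟧ ℕ.* g (d ∷ w)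
  inner d = begin
    _ ≡⟨ ∑-cong (words m n) (λ v → trans
           (cong (g (d ∷ v) ℕ.*_) (dist1-split s (dist w v)))
           (rearrange (g (d ∷ v)) ⟦ s ≡ᵇ 0 ⟧ _ ⟦ s ≡ᵇ 1 ⟧ _)) ⟩
    _ ≡⟨ ∑-+ (words m n) _ _ ⟩
    _ ≡⟨ cong₂ ℕ._+_ (∑-* ⟦ s ≡ᵇ 0 ⟧ (words m n) _) (∑-* ⟦ s ≡ᵇ 1 ⟧ (words m n) _) ⟩
    _ ≡⟨ cong₂ ℕ._+_ refl (cong (⟦ s ≡ᵇ 1 ⟧ ℕ.*_) (∑-word-dist0 w (λ v → g (d ∷ v)))) ⟩
    _ ∎
    where s = ∣ toℕ c - toℕ d ∣

n<ᵇn : ∀ n → (n <ᵇ n) ≡ false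
n<ᵇn zero    = refl
n<ᵇn (suc n) = n<ᵇn n

-- Vertices and degrees by first letter

module _ (p q : ℕ) where

  private
    -- In terms of `p = a - 2` and `q = b - 1` both recursions have natural coefficients.
    a b : ℕ
    a = suc (suc p)
    b = suc q

  open Horadam a b

  -- z tells whether the preceding letter is 0.
  permitted : Bool → ℕ → Bool
  permitted z i = (i <ᵇ a) ∨ z

  -- Reads the word from the left: the state `z` replaces the search for a preceding position `j` in
  -- `IsVertex`, so a first letter can be split off.
  valid : ∀ {n} → Bool → Word (a ℕ.+ b) n → Bool
  valid z []      = true
  valid z (c ∷ w) = permitted z (toℕ c) ∧ valid (toℕ c ≡ᵇ 0) w

  -- Generalizes `IsVertex` for the induction: the rest of a vertex after a leading `0` need not be
  -- a vertex, since its first letter may rely on that `0`.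
  IsContinuation : ∀ {n} → Bool → Word (a ℕ.+ b) n → Set
  IsContinuation {n} z x = (i : Fin n) → a ℕ.≤ toℕ (lookup x i) →
    (toℕ i ≡ 0 × T z) ⊎ ∃[ j ] (suc (toℕ j) ≡ toℕ i × toℕ (lookup x j) ≡ 0)

  continuation⇒valid : ∀ {n} z (x : Word (a ℕ.+ b) n) → IsContinuation z x → T (valid z x)
  continuation⇒valid z []      h = tt
  continuation⇒valid z (c ∷ w) h =
    Equivalence.from T-∧ (first (toℕ c ℕ.<? a) , continuation⇒valid (toℕ c ≡ᵇ 0) w rest)
    where
    first : Dec (toℕ c ℕ.< a) → T (permitted z (toℕ c))
    first (yes c<a) = Equivalence.from T-∨ (inj₁ (ℕₚ.<⇒<ᵇ c<a))
    first (no  c≮a) with h zero (ℕₚ.≮⇒≥ c≮a)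
    -- The other alternative would need a position `j` with `suc (toℕ j) ≡ 0`.
    ... | inj₁ (_ , tz) = Equivalence.from T-∨ (inj₂ tz)

    rest : IsContinuation (toℕ c ≡ᵇ 0) w
    rest i a≤ with h (suc i) a≤
    ... | inj₂ (zero  , e , c≡0) = inj₁ (sym (ℕₚ.suc-injective e) , ℕₚ.≡⇒≡ᵇ _ 0 c≡0)
    ... | inj₂ (suc j , e , l≡0) = inj₂ (j , ℕₚ.suc-injective e , l≡0)

  valid⇒continuation : ∀ {n} z (x : Word (a ℕ.+ b) n) → T (valid z x) → IsContinuation z x
  valid⇒continuation z (c ∷ w) t zero a≤c with Equivalence.to T-∨ (proj₁ (Equivalence.to T-∧ t))
  ... | inj₁ c<a = ⊥-elim (ℕₚ.<⇒≱ (ℕₚ.<ᵇ⇒< _ _ c<a) a≤c)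
  ... | inj₂ tz  = inj₁ (refl , tz)
  valid⇒continuation z (c ∷ w) t (suc i) a≤
    with valid⇒continuation (toℕ c ≡ᵇ 0) w (proj₂ (Equivalence.to (T-∧ {permitted z (toℕ c)}) t)) i a≤
  ... | inj₁ (e , c≡0)     = inj₂ (zero , cong suc (sym e) , ℕₚ.≡ᵇ⇒≡ _ 0 c≡0)
  ... | inj₂ (j , e , l≡0) = inj₂ (suc j , cong suc e , l≡0)

  isVertex≡valid : ∀ {n} (x : Word (a ℕ.+ b) n) → does (isVertex? x) ≡ valid false x
  isVertex≡valid x = does-⇔ (mk⇔
    (λ h → continuation⇒valid false x (λ i a≤ → inj₂ (h i a≤)))
    (λ t i a≤ → [ (λ ()) , (λ j → j) ]′ (valid⇒continuation false x t i a≤)))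
    (isVertex? x) (T? (valid false x))

  -- With `true` this counts the neighbours of `x` among all words that may follow a `0`, that is,
  -- the ways to change the rest of a word behind a fixed `0`.
  neighbours : ∀ {n} → Bool → Word (a ℕ.+ b) n → ℕ
  neighbours {n} z x = ∑ (words (a ℕ.+ b) n) (λ y → ⟦ valid z y ⟧ ℕ.* ⟦ dist x y ≡ᵇ 1 ⟧)

  degree≡neighbours : ∀ {n} (x : Word (a ℕ.+ b) n) → degree x ≡ neighbours false x
  degree≡neighbours {n} x = begin
    degree x ≡⟨ length-filter (adjacent? x) (vertices n) ⟩
    _        ≡⟨ ∑-filter isVertex? (words (a ℕ.+ b) n) _ ⟩
    _        ≡⟨ ∑-cong (words (a ℕ.+ b) n) (λ y → cong₂ ℕ._*_ (cong ⟦_⟧ (isVertex≡valid y)) refl) ⟩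
    neighbours false x ∎

  -- `F i` indicates whether `i` may replace the first letter. As `c` itself is permitted, changes
  -- behind it are restricted only by the state that `c` leaves.
  neighbours-∷ : ∀ {n} z c (w : Word (a ℕ.+ b) n) → T (permitted z (toℕ c)) →
    let F = λ i → ⟦ permitted z i ∧ valid (i ≡ᵇ 0) w ⟧ in
    neighbours z (c ∷ w) ≡ neighbours (toℕ c ≡ᵇ 0) w
      ℕ.+ (at-predecessor (toℕ c) F ℕ.+ at-successor (a ℕ.+ b) (toℕ c) F)
  neighbours-∷ {n} z c w ok = trans (∑-word-dist1 c w (λ y → ⟦ valid z y ⟧)) (cong₂ ℕ._+_
    (∑-cong (words (a ℕ.+ b) n)
      (λ v → cong (λ t → ⟦ t ∧ valid (toℕ c ≡ᵇ 0) v ⟧ ℕ.* ⟦ dist w v ≡ᵇ 1 ⟧) (T⇒≡true ok)))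
    (∑-letter-dist1 c (λ i → ⟦ permitted z i ∧ valid (i ≡ᵇ 0) w ⟧)))

  -- A leading `0` can only become `1`, which is always permitted because `a ≥ 2`; the rest then has
  -- to be valid after a nonzero letter.
  neighbours-zero : ∀ {n} z (w : Word (a ℕ.+ b) n) →
    neighbours z (zero ∷ w) ≡ neighbours true w ℕ.+ ⟦ valid false w ⟧
  neighbours-zero z w = neighbours-∷ z zero w tt

  valid-after-zero : ∀ {n} (w : Word (a ℕ.+ b) n) → T (valid false w) → T (valid true w)
  valid-after-zero []      t = tt
  valid-after-zero (c ∷ w) t = Equivalence.from (T-∧ {permitted true (toℕ c)})
    ( subst T (sym (∨-zeroʳ (toℕ c <ᵇ a))) tt
    , proj₂ (Equivalence.to (T-∧ {permitted false (toℕ c)}) t))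

  permitted-pred : ∀ z i → T (permitted z (suc i)) → T (permitted z i)
  permitted-pred z i t with Equivalence.to (T-∨ {suc i <ᵇ a}) t
  ... | inj₁ i<a = Equivalence.from (T-∨ {i <ᵇ a}) (inj₁ (ℕₚ.<⇒<ᵇ (ℕₚ.<-trans (ℕₚ.n<1+n i) (ℕₚ.<ᵇ⇒< (suc i) a i<a))))
  ... | inj₂ tz  = Equivalence.from (T-∨ {i <ᵇ a}) (inj₂ tz)

  -- The `suc` is the lowered letter: permitted letters are closed under predecessors, and if it
  -- becomes `0`, the rest only gains freedom. A raised letter is nonzero, so whether it is allowed
  -- depends on `z` alone.
  neighbours-suc : ∀ {n} z c (w : Word (a ℕ.+ b) n) → T (permitted z (suc (toℕ c))) → T (valid false w) →
    neighbours z (suc c ∷ w)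
      ≡ suc (at-successor (a ℕ.+ b) (suc (toℕ c)) (λ i → ⟦ permitted z i ⟧)) ℕ.+ neighbours false w
  neighbours-suc z c w ok t = trans (neighbours-∷ z (suc c) w ok)
    (trans (ℕₚ.+-comm (neighbours false w) _) (cong (ℕ._+ neighbours false w)
      (cong₂ ℕ._+_ (below (toℕ c) (permitted-pred z (toℕ c) ok)) above)))
    where
    below : ∀ i → T (permitted z i) → ⟦ permitted z i ∧ valid (i ≡ᵇ 0) w ⟧ ≡ 1
    below zero    _ rewrite T⇒≡true (valid-after-zero w t) = refl
    below (suc i) ok rewrite T⇒≡true ok | T⇒≡true t = refl

    above : at-successor (a ℕ.+ b) (suc (toℕ c)) (λ i → ⟦ permitted z i ∧ valid (i ≡ᵇ 0) w ⟧)
          ≡ at-successor (a ℕ.+ b) (suc (toℕ c)) (λ i → ⟦ permitted z i ⟧)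
    above with suc (suc (toℕ c)) <ᵇ a ℕ.+ b
    ... | false = refl
    ... | true  rewrite T⇒≡true t with permitted z (suc (suc (toℕ c)))
    ...   | true  = refl
    ...   | false = refl

  -- For z = true, the indicator counts the neighbour of 0 w obtained by changing the 0 to 1.
  total : Bool → ℕ → (ℕ → ℕ) → ℕ
  total z n φ = ∑ (words (a ℕ.+ b) n)
    (λ w → ⟦ valid z w ⟧ ℕ.* φ (⟦ z ∧ valid false w ⟧ ℕ.+ neighbours z w))

  startingWith : ∀ n → Bool → Fin (a ℕ.+ b) → (ℕ → ℕ) → ℕ
  startingWith n z c φ = ∑ (words (a ℕ.+ b) n)
    (λ w → ⟦ valid z (c ∷ w) ⟧ ℕ.* φ (⟦ z ∧ valid false (c ∷ w) ⟧ ℕ.+ neighbours z (c ∷ w)))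

  -- If a `0` precedes, it too can be changed to `1`, since a word beginning with `0` may follow any
  -- letter. This is the shift by `⟦ z ⟧`.
  startingWith-zero : ∀ n z φ → startingWith n z zero φ ≡ total true n (λ d → φ (⟦ z ⟧ ℕ.+ d))
  startingWith-zero n z φ = ∑-cong (words (a ℕ.+ b) n) term
    where
    term : ∀ w → ⟦ valid z (zero ∷ w) ⟧ ℕ.* φ (⟦ z ∧ valid false (zero ∷ w) ⟧ ℕ.+ neighbours z (zero ∷ w))
               ≡ ⟦ valid true w ⟧ ℕ.* φ (⟦ z ⟧ ℕ.+ (⟦ true ∧ valid false w ⟧ ℕ.+ neighbours true w))
    term w rewrite neighbours-zero z w with valid true w
    ... | false = refl
    ... | true  = cong (λ d → φ d ℕ.+ 0) (cong₂ ℕ._+_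
      (cong ⟦_⟧ (∧-identityʳ z)) (ℕₚ.+-comm (neighbours true w) ⟦ valid false w ⟧))

  -- What the letter `suc i` adds to the degree of the rest: one for changing a preceding `0` to
  -- `1`, possible only if `suc i < a`, one for lowering the letter, and one for raising it where
  -- allowed.
  increment : Bool → ℕ → ℕ
  increment z i = ⟦ z ∧ permitted false (suc i) ⟧
    ℕ.+ suc (at-successor (a ℕ.+ b) (suc i) (λ j → ⟦ permitted z j ⟧))

  startingWith-suc : ∀ n z c φ {k} → T (permitted z (suc (toℕ c))) → increment z (toℕ c) ≡ k →
    startingWith n z (suc c) φ ≡ total false n (λ d → φ (k ℕ.+ d))
  startingWith-suc n z c φ ok refl = ∑-cong (words (a ℕ.+ b) n) term
    where
    term : ∀ w → ⟦ valid z (suc c ∷ w) ⟧ ℕ.* φ (⟦ z ∧ valid false (suc c ∷ w) ⟧ ℕ.+ neighbours z (suc c ∷ w))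
               ≡ ⟦ valid false w ⟧ ℕ.* φ (increment z (toℕ c) ℕ.+ neighbours false w)
    term w with valid false w in eq
    ... | false rewrite ∧-zeroʳ (permitted z (suc (toℕ c))) = refl
    ... | true  rewrite neighbours-suc z c w ok (subst T (sym eq) tt)
                      | T⇒≡true ok | ∧-identityʳ (permitted false (suc (toℕ c)))
      = cong (λ d → φ d ℕ.+ 0) (sym (ℕₚ.+-assoc ⟦ z ∧ permitted false (suc (toℕ c)) ⟧ _ _))

  -- Degree contributed by each kind of nonzero letter

  <⇒permitted : ∀ z {i} → i ℕ.< a → permitted z i ≡ true
  <⇒permitted z i<a rewrite T⇒≡true (ℕₚ.<⇒<ᵇ i<a) = refl

  ≥⇒permitted : ∀ z {i} → a ℕ.≤ i → permitted z i ≡ z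
  ≥⇒permitted z {i} a≤i with i <ᵇ a in eq
  ... | false = refl
  ... | true  = ⊥-elim (ℕₚ.<⇒≱ (ℕₚ.<ᵇ⇒< i a (subst T (sym eq) tt)) a≤i)

  increment-low : ∀ z {i} → i ℕ.< p → increment z i ≡ ⟦ z ⟧ ℕ.+ 2
  increment-low z {i} i<p
    rewrite <⇒permitted false {suc i} (s≤s (ℕₚ.m≤n⇒m≤1+n i<p))
          | T⇒≡true (ℕₚ.<⇒<ᵇ (ℕₚ.<-≤-trans (s≤s (s≤s i<p)) (ℕₚ.m≤m+n a b)))
          | <⇒permitted z {suc (suc i)} (s≤s (s≤s i<p))
          | ∧-identityʳ z = refl

  -- The letter `suc p` is `a - 1`. Raising it gives `a`, which needs a preceding `0`; hence the
  -- second `⟦ z ⟧`.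
  increment-top : ∀ z → increment z p ≡ ⟦ z ⟧ ℕ.+ suc ⟦ z ⟧
  increment-top z
    rewrite <⇒permitted false {suc p} ℕₚ.≤-refl
          | T⇒≡true (ℕₚ.<⇒<ᵇ (ℕₚ.m<m+n a {b} (s≤s z≤n)))
          | ≥⇒permitted z {a} ℕₚ.≤-refl
          | ∧-identityʳ z = refl

  -- The preceding `0` cannot change, because a letter of value at least `a` depends on it. Lowering
  -- and raising remain, and for the last letter only lowering.
  increment-extra : ∀ {i} → i ℕ.< q → increment true (suc p ℕ.+ i) ≡ 2
  increment-extra {i} i<q
    rewrite ≥⇒permitted false {a ℕ.+ i} (ℕₚ.m≤m+n a i)
          | T⇒≡true (ℕₚ.<⇒<ᵇ (subst (ℕ._< a ℕ.+ b) (ℕₚ.+-suc a i) (ℕₚ.+-monoʳ-< a (s≤s i<q))))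
          | ∨-zeroʳ (suc (a ℕ.+ i) <ᵇ a) = refl

  increment-last : increment true (suc p ℕ.+ q) ≡ 1
  increment-last
    rewrite ≥⇒permitted false {a ℕ.+ q} (ℕₚ.m≤m+n a q)
          | ℕₚ.+-suc p q | n<ᵇn (p ℕ.+ q) = refl

  -- The two recursions and the elimination of `total true`

  total-suc : ∀ z n φ → total z (suc n) φ
    ≡ total true n (λ d → φ (⟦ z ⟧ ℕ.+ d))
      ℕ.+ (p ℕ.* total false n (λ d → φ (⟦ z ⟧ ℕ.+ 2 ℕ.+ d)) ℕ.+ total false n (λ d → φ (⟦ z ⟧ ℕ.+ suc ⟦ z ⟧ ℕ.+ d))
        ℕ.+ ∑ (allFin b) (λ c → startingWith n z (suc (suc p ↑ʳ c)) φ))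
  total-suc z n φ = begin
    _ ≡⟨ ∑-words-suc (a ℕ.+ b) n _ ⟩
    -- The letter `0` is split off, then the `p` letters from `1` to `a - 2`, then `a - 1`. The sum
    -- over the remaining `b` letters stays unevaluated, as its value depends on whether `z` permits
    -- them.
    _ ≡⟨ ∑-allFin-suc (suc p ℕ.+ b) (λ c → startingWith n z c φ) ⟩
    _ ≡⟨ cong₂ ℕ._+_ (startingWith-zero n z φ) (begin
      _ ≡⟨ ∑-allFin-+ (suc p) b (λ c → startingWith n z (suc c) φ) ⟩
      _ ≡⟨ cong₂ ℕ._+_ (∑-allFin-init-last p (λ c → startingWith n z (suc (c ↑ˡ b)) φ) low top) refl ⟩
      _ ∎) ⟩
    _ ∎
    where
    i≤p⇒permitted : ∀ {i} → i ℕ.≤ p → T (permitted z (suc i))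
    i≤p⇒permitted i≤p = subst T (sym (<⇒permitted z (s≤s (s≤s i≤p)))) tt

    low : ∀ c → toℕ c ℕ.< p → startingWith n z (suc (c ↑ˡ b)) φ ≡ total false n (λ d → φ (⟦ z ⟧ ℕ.+ 2 ℕ.+ d))
    low c c<p =
      startingWith-suc n z (c ↑ˡ b) φ (i≤p⇒permitted (subst (ℕ._≤ p) (sym (toℕ-↑ˡ c b)) (ℕₚ.<⇒≤ c<p)))
        (trans (cong (increment z) (toℕ-↑ˡ c b)) (increment-low z c<p))

    top : ∀ c → toℕ c ≡ p → startingWith n z (suc (c ↑ˡ b)) φ ≡ total false n (λ d → φ (⟦ z ⟧ ℕ.+ suc ⟦ z ⟧ ℕ.+ d))
    top c c≡p =
      startingWith-suc n z (c ↑ˡ b) φ (i≤p⇒permitted (ℕₚ.≤-reflexive c≡p'))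
        (trans (cong (increment z) c≡p') (increment-top z))
      where c≡p' = trans (toℕ-↑ˡ c b) c≡p

  total-false-suc : ∀ n φ → total false (suc n) φ
    ≡ total true n φ ℕ.+ (p ℕ.* total false n (λ d → φ (2 ℕ.+ d)) ℕ.+ total false n (λ d → φ (1 ℕ.+ d)))
  total-false-suc n φ = trans (total-suc false n φ) (cong (total true n φ ℕ.+_)
    (trans (cong₂ ℕ._+_ refl (∑-zero (allFin b) none)) (ℕₚ.+-identityʳ _)))
    where
    none : ∀ c → startingWith n false (suc (suc p ↑ʳ c)) φ ≡ 0
    none c = ∑-zero (words (a ℕ.+ b) n) (λ w → cong₂ ℕ._*_ (cong (λ t → ⟦ t ∧ valid false w ⟧)
      (≥⇒permitted false (subst (λ i → a ℕ.≤ suc i) (sym (toℕ-↑ʳ (suc p) c)) (ℕₚ.m≤m+n a (toℕ c))))) refl)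

  -- After a `0` the letter `a - 1` can be raised to `a`, so it shifts by 3 like the smaller nonzero
  -- letters: lowering, raising, and changing the preceding `0`.
  total-true-suc : ∀ n φ → total true (suc n) φ
    ≡ total true n (λ d → φ (1 ℕ.+ d))
      ℕ.+ (p ℕ.* total false n (λ d → φ (3 ℕ.+ d)) ℕ.+ total false n (λ d → φ (3 ℕ.+ d))
        ℕ.+ (q ℕ.* total false n (λ d → φ (2 ℕ.+ d)) ℕ.+ total false n (λ d → φ (1 ℕ.+ d))))
  total-true-suc n φ = trans (total-suc true n φ) (cong (total true n (λ d → φ (1 ℕ.+ d)) ℕ.+_)
    (cong (p ℕ.* total false n (λ d → φ (3 ℕ.+ d)) ℕ.+ total false n (λ d → φ (3 ℕ.+ d)) ℕ.+_)
    (∑-allFin-init-last q (λ c → startingWith n true (suc (suc p ↑ʳ c)) φ) extra last)))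
    where
    ok : ∀ i → T (permitted true i)
    ok i = Equivalence.from (T-∨ {i <ᵇ a}) (inj₂ tt)

    extra : ∀ c → toℕ c ℕ.< q → startingWith n true (suc (suc p ↑ʳ c)) φ ≡ total false n (λ d → φ (2 ℕ.+ d))
    extra c c<q = startingWith-suc n true (suc p ↑ʳ c) φ (ok (suc (toℕ (suc p ↑ʳ c))))
      (trans (cong (increment true) (toℕ-↑ʳ (suc p) c)) (increment-extra c<q))

    last : ∀ c → toℕ c ≡ q → startingWith n true (suc (suc p ↑ʳ c)) φ ≡ total false n (λ d → φ (1 ℕ.+ d))
    last c c≡q = startingWith-suc n true (suc p ↑ʳ c) φ (ok (suc (toℕ (suc p ↑ʳ c))))
      (trans (cong (increment true) (trans (toℕ-↑ʳ (suc p) c) (cong (suc p ℕ.+_) c≡q))) increment-last)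

  -- Since `b - 2 = q - 1` may be negative, the coefficient on the right is `q`, and the surplus
  -- copy is balanced on the left; this keeps the identity in ℕ.
  total-recurrence : ∀ n φ → let E = total false in
    E (2 ℕ.+ n) φ ℕ.+ E n (λ d → φ (2 ℕ.+ d))
      ≡ 2 ℕ.* E (1 ℕ.+ n) (λ d → φ (1 ℕ.+ d)) ℕ.+ p ℕ.* E (1 ℕ.+ n) (λ d → φ (2 ℕ.+ d))
        ℕ.+ E n (λ d → φ (1 ℕ.+ d)) ℕ.+ q ℕ.* E n (λ d → φ (2 ℕ.+ d)) ℕ.+ E n (λ d → φ (3 ℕ.+ d))
  total-recurrence n φ
    -- After these expansions `total true n` with `φ` shifted by 1 occurs exactly twice on each
    -- side, so it cancels without being known.
    rewrite total-false-suc (suc n) φ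
          | total-true-suc n φ
          | total-false-suc n (λ d → φ (1 ℕ.+ d))
    = rearrange p q (total true n (λ d → φ (1 ℕ.+ d))) (E n 1) (E n 2) (E n 3) (E (suc n) 2)
    where
    E : ℕ → ℕ → ℕ
    E m k = total false m (λ d → φ (k ℕ.+ d))

    rearrange : ∀ p q Z E₁ E₂ E₃ E′ →
      Z ℕ.+ (p ℕ.* E₃ ℕ.+ E₃ ℕ.+ (q ℕ.* E₂ ℕ.+ E₁)) ℕ.+ (p ℕ.* E′ ℕ.+ (Z ℕ.+ (p ℕ.* E₃ ℕ.+ E₂))) ℕ.+ E₂
        ≡ 2 ℕ.* (Z ℕ.+ (p ℕ.* E₃ ℕ.+ E₂)) ℕ.+ p ℕ.* E′ ℕ.+ E₁ ℕ.+ q ℕ.* E₂ ℕ.+ E₃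
    rearrange = ℕ-Solver.solve-∀

  -- Translation to `Δ` and integer coefficients

  Δ≡total : ∀ n k → Δ n (+ k) ≡ + total false n (λ d → ⟦ d ≡ᵇ k ⟧)
  Δ≡total n k = cong +_ (begin
    _ ≡⟨ length-filter (λ x → degree x ℕ.≟ k) (vertices n) ⟩
    _ ≡⟨ ∑-filter isVertex? (words (a ℕ.+ b) n) (λ x → ⟦ degree x ≡ᵇ k ⟧) ⟩
    _ ≡⟨ ∑-cong (words (a ℕ.+ b) n) (λ x → cong₂ ℕ._*_
           (cong ⟦_⟧ (isVertex≡valid x)) (cong (λ d → ⟦ d ≡ᵇ k ⟧) (degree≡neighbours x))) ⟩
    _ ∎)

  Δ-shift : ∀ n k j → Δ n (+ k - + j) ≡ + total false n (λ d → ⟦ j ℕ.+ d ≡ᵇ k ⟧)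
  Δ-shift n k zero rewrite ℕₚ.+-identityʳ k = Δ≡total n k
  -- The index is negative, where `Δ` is 0 by convention; correspondingly no `d` satisfies
  -- `suc j ℕ.+ d ≡ 0`.
  Δ-shift n zero (suc j) = cong +_ (sym (∑-zero (words (a ℕ.+ b) n) (λ w → ℕₚ.*-zeroʳ ⟦ valid false w ⟧)))
  Δ-shift n (suc k) (suc j) = trans
    (cong (Δ n) (trans (m-n≡m⊖n (suc k) (suc j)) (trans ([1+m]⊖[1+n]≡m⊖n k j) (sym (m-n≡m⊖n k j)))))
    (Δ-shift n k j)

  Δ-recurrence : ∀ n k → Δ (2 ℕ.+ n) (+ k) ≡
    + 2 * Δ (1 ℕ.+ n) (+ k - + 1) + (+ a - + 2) * Δ (1 ℕ.+ n) (+ k - + 2)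
    + Δ n (+ k - + 1) + (+ b - + 2) * Δ n (+ k - + 2) + Δ n (+ k - + 3)
  Δ-recurrence n k
    rewrite Δ≡total (2 ℕ.+ n) k | Δ-shift (1 ℕ.+ n) k 1 | Δ-shift (1 ℕ.+ n) k 2
          | Δ-shift n k 1 | Δ-shift n k 2 | Δ-shift n k 3
    = solve-for (E (2 ℕ.+ n) 0) (E (1 ℕ.+ n) 1) (E (1 ℕ.+ n) 2) (E n 1) (E n 2) (E n 3)
        (total-recurrence n (λ d → ⟦ d ≡ᵇ k ⟧))
    where
    E : ℕ → ℕ → ℕ
    E m j = total false m (λ d → ⟦ j ℕ.+ d ≡ᵇ k ⟧)

    -- `+ 2 + p` and `+ 1 + q` are the forms to which `+ a` and `+ b` unfold; subtracting `D` turns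
    -- its coefficient `q` into `b - 2`.
    rearrange : ∀ p q A B C D F →
      + 2 * A + p * B + C + q * D + F - D
        ≡ + 2 * A + (+ 2 + p - + 2) * B + C + (+ 1 + q - + 2) * D + F
    rearrange = solve-∀

    cancel : ∀ X D → X ≡ X + D - D
    cancel = solve-∀

    solve-for : ∀ X A B C D F → X ℕ.+ D ≡ 2 ℕ.* A ℕ.+ p ℕ.* B ℕ.+ C ℕ.+ q ℕ.* D ℕ.+ F →
      + X ≡ + 2 * + A + (+ a - + 2) * + B + + C + (+ b - + 2) * + D + + F
    solve-for X A B C D F eq = begin
      -- Adding and subtracting `D` makes the identity over ℕ applicable.
      + X                                 ≡⟨ cancel (+ X) (+ D) ⟩
      + (X ℕ.+ D) - + D                   ≡⟨ cong (λ t → + t - + D) eq ⟩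
      + (2 ℕ.* A) + + (p ℕ.* B) + + C + + (q ℕ.* D) + + F - + D
        ≡⟨ cong₂ (λ s t → s + + C + t + + F - + D)
             (cong₂ _+_ (pos-* 2 A) (pos-* p B)) (pos-* q D) ⟩
      + 2 * + A + + p * + B + + C + + q * + D + + F - + D
        ≡⟨ rearrange (+ p) (+ q) (+ A) (+ B) (+ C) (+ D) (+ F) ⟩
      _ ∎

  -- Initial values

  total-false-0 : ∀ φ → total false 0 φ ≡ φ 0
  total-false-0 φ = trans (ℕₚ.+-identityʳ _) (ℕₚ.+-identityʳ _)

  -- The empty word behind a `0` stands for the vertex `0` of length one, whose only neighbour is
  -- `1`.
  total-true-0 : ∀ φ → total true 0 φ ≡ φ 1
  total-true-0 φ = trans (ℕₚ.+-identityʳ _) (ℕₚ.+-identityʳ _)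

  -- The cube of dimension 1 is a path on `a` vertices: two ends of degree 1 and `p` inner vertices
  -- of degree 2.
  total-false-1 : ∀ φ → total false 1 φ ≡ φ 1 ℕ.+ (p ℕ.* φ 2 ℕ.+ φ 1)
  total-false-1 φ = trans (total-false-suc 0 φ) (cong₂ ℕ._+_ (total-true-0 φ) (cong₂ ℕ._+_
    (cong (p ℕ.*_) (total-false-0 (λ d → φ (2 ℕ.+ d)))) (total-false-0 (λ d → φ (1 ℕ.+ d)))))

  Δ-0 : ∀ k → Δ 0 (+ k) ≡ + ⟦ 0 ≡ᵇ k ⟧
  Δ-0 k = trans (Δ≡total 0 k) (cong +_ (total-false-0 (λ d → ⟦ d ≡ᵇ k ⟧)))

  Δ-1 : ∀ k → Δ 1 (+ k) ≡ + (⟦ 1 ≡ᵇ k ⟧ ℕ.+ (p ℕ.* ⟦ 2 ≡ᵇ k ⟧ ℕ.+ ⟦ 1 ≡ᵇ k ⟧))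
  Δ-1 k = trans (Δ≡total 1 k) (cong +_ (total-false-1 (λ d → ⟦ d ≡ᵇ k ⟧)))

  Δ-0-other : ∀ k → k ≢ + 0 → Δ 0 k ≡ + 0
  Δ-0-other (+ zero)  k≢0 = ⊥-elim (k≢0 refl)
  Δ-0-other (+ suc k) k≢0 = Δ-0 (suc k)
  Δ-0-other -[1+ k ]  k≢0 = refl

  Δ-1-1 : Δ 1 (+ 1) ≡ + 2
  Δ-1-1 = trans (Δ-1 1) (cong (λ t → + (1 ℕ.+ (t ℕ.+ 1))) (ℕₚ.*-zeroʳ p))

  Δ-1-2 : Δ 1 (+ 2) ≡ + a - + 2
  Δ-1-2 = trans (Δ-1 2) (cong +_ (trans (ℕₚ.+-identityʳ _) (ℕₚ.*-identityʳ p)))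

  Δ-1-other : ∀ k → k ≢ + 1 → k ≢ + 2 → Δ 1 k ≡ + 0
  Δ-1-other -[1+ k ]              k≢1 k≢2 = refl
  Δ-1-other (+ 1)                 k≢1 k≢2 = ⊥-elim (k≢1 refl)
  Δ-1-other (+ 2)                 k≢1 k≢2 = ⊥-elim (k≢2 refl)
  Δ-1-other (+ 0)                 k≢1 k≢2 = trans (Δ-1 0) (cong (λ t → + (t ℕ.+ 0)) (ℕₚ.*-zeroʳ p))
  Δ-1-other (+ suc (suc (suc k))) k≢1 k≢2 =
    trans (Δ-1 (suc (suc (suc k)))) (cong (λ t → + (t ℕ.+ 0)) (ℕₚ.*-zeroʳ p))

theorem11 : (a b : ℕ) → 2 ℕ.≤ a → 1 ℕ.≤ b →
    let open Horadam a b in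
    ((n k : ℕ) → 2 ℕ.≤ n →
    Δ n (+ k) ≡ + 2 * Δ (n ∸ 1) (+ k - + 1)
    + (+ a - + 2) * Δ (n ∸ 1) (+ k - + 2)
    + Δ (n ∸ 2) (+ k - + 1)
    + (+ b - + 2) * Δ (n ∸ 2) (+ k - + 2)
    + Δ (n ∸ 2) (+ k - + 3))
    × Δ 0 (+ 0) ≡ + 1
    × ((k : ℤ) → k ≢ + 0 → Δ 0 k ≡ + 0)
    × Δ 1 (+ 1) ≡ + 2
    × Δ 1 (+ 2) ≡ + a - + 2
    × ((k : ℤ) → k ≢ + 1 → k ≢ + 2 → Δ 1 k ≡ + 0)
theorem11 (suc (suc p)) (suc q) (s≤s (s≤s z≤n)) (s≤s z≤n) =
    (λ { (suc (suc n)) k (s≤s (s≤s z≤n)) → Δ-recurrence p q n k })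
  , Δ-0 p q 0
  , Δ-0-other p q
  , Δ-1-1 p q
  , Δ-1-2 p q
  , Δ-1-other p q
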